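{- Let $T$ be an add-composite tree, i.e. a tree with $n_T>1$ that is not add-prime. Then $T$ can be uniquely factorized under addition in $s_T$ factors: $T$ is a sum $T=A_1+\cdots+A_{s_T}$ of $s_T$ add-prime trees, and any expression of $T$ as a sum of add-prime trees has the same terms with the same multiplicities, up to order.
   Context: A "tree" is a finite non-empty rooted unordered tree; two trees are regarded as equal if they are isomorphic as rooted trees. $\mathbf{1}$ is the tree with exactly one vertex, $n_T$ is the number of vertices of $T$, and $r(T)$ is its root. The subtrees of $r(T)$ are the trees rooted at the children of $r(T)$, each consisting of a child and all its descendants; $s_T$ is the number of subtrees of $r(T)$. Addition: $A+B$ is the tree obtained by merging the roots $r(A)$ and $r(B)$ into a single new root, so that the subtrees of $r(A)$ together with the subtrees of $r(B)$ (counted with multiplicity) become the subtrees of the new root. Addition is commutative and associative, so sums of several terms are written without parentheses. A tree $T$ with $n_T>1$ is add-prime if it can be generated by addition only if the terms are $\mathbf{1}$ and $T$, i.e. $T=A+B$ implies that one of $A,B$ is $\mathbf{1}$ and the other is $T$. In particular add-prime trees are different from $\mathbf{1}$. -}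

module Defs where

open import Data.List.Base using (List; []; _∷_; _++_; length; foldr)
open import Data.List.Membership.Propositional using (_∈_)
open import Data.List.Relation.Unary.All using (All)
open import Data.Nat.Base using (ℕ; suc; _+_; _<_)
open import Data.Product.Base using (_×_)
open import Data.Sum.Base using (_⊎_)
open import Function.Bundles using (_↔_; _⇔_; mk⇔; module Inverse; module Equivalence)
open import Function.Construct.Identity using (↔-id; ⇔-id)
open import Function.Construct.Symmetry using (↔-sym; ⇔-sym)
open import Function.Construct.Composition using (_↔-∘_; _⇔-∘_)
open import Level using (0ℓ)
open import Relation.Binary.Bundles using (Setoid)
open import Relation.Binary.PropositionalEquality
  using (_≡_; refl; sym; trans; cong; subst₂)
open import Relation.Nullary.Negation.Core using (¬_)

-- The list of subtrees of the root carries an arbitrary order; trees are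
-- unordered because they are only ever compared up to _≅_ below.
data Tree : Set where
  node : List Tree → Tree

𝟏 : Tree
𝟏 = node []

subtrees : Tree → List Tree
subtrees (node ts) = ts

#subtrees : Tree → ℕ
#subtrees T = length (subtrees T)

#vertices  : Tree → ℕ
#vertices⋆ : List Tree → ℕ
#vertices (node ts) = suc (#vertices⋆ ts)
#vertices⋆ []       = 0
#vertices⋆ (t ∷ ts) = #vertices t + #vertices⋆ ts

-- A proof of t ∈ ts is a position in ts, so equal trees occurring at
-- different positions contribute distinct vertices.
data Vertex : Tree → Set where
  root  : ∀ {ts} → Vertex (node ts)
  below : ∀ {ts t} → t ∈ ts → Vertex t → Vertex (node ts)

rootOf : (T : Tree) → Vertex T
rootOf (node ts) = root

infix 4 _parentOf_ _≅_

data _parentOf_ : {T : Tree} → Vertex T → Vertex T → Set where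
  top   : ∀ {ts t} (p : t ∈ ts) → root parentOf below p (rootOf t)
  below : ∀ {ts t} (p : t ∈ ts) {v w : Vertex t} →
          v parentOf w → below p v parentOf below p w

record _≅_ (A B : Tree) : Set where
  field
    vertices : Vertex A ↔ Vertex B
  open Inverse vertices public using (to; from; strictlyInverseˡ; strictlyInverseʳ)
  field
    root-preserved   : to (rootOf A) ≡ rootOf B
    parent-preserved : ∀ v w → v parentOf w ⇔ to v parentOf to w

≅-refl : ∀ {A} → A ≅ A
≅-refl = record
  { vertices         = ↔-id _
  ; root-preserved   = refl
  ; parent-preserved = λ _ _ → ⇔-id _
  }

≅-sym : ∀ {A B} → A ≅ B → B ≅ A
≅-sym f = record
  { vertices         = ↔-sym f.vertices
  ; root-preserved   = trans (cong f.from (sym f.root-preserved)) (f.strictlyInverseʳ _)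
  ; parent-preserved = λ v w → mk⇔
      (λ e → Equivalence.from (f.parent-preserved (f.from v) (f.from w))
        (subst₂ _parentOf_ (sym (f.strictlyInverseˡ v)) (sym (f.strictlyInverseˡ w)) e))
      (λ e → subst₂ _parentOf_ (f.strictlyInverseˡ v) (f.strictlyInverseˡ w)
        (Equivalence.to (f.parent-preserved (f.from v) (f.from w)) e))
  }
  where module f = _≅_ f

≅-trans : ∀ {A B C} → A ≅ B → B ≅ C → A ≅ C
≅-trans f g = record
  { vertices         = g.vertices ↔-∘ f.vertices
  ; root-preserved   = trans (cong g.to f.root-preserved) g.root-preserved
  ; parent-preserved = λ v w →
      g.parent-preserved (f.to v) (f.to w) ⇔-∘ f.parent-preserved v w
  }
  where
  module f = _≅_ f
  module g = _≅_ g

TreeSetoid : Setoid 0ℓ 0ℓ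
TreeSetoid = record
  { Carrier       = Tree
  ; _≈_           = _≅_
  ; isEquivalence = record { refl = ≅-refl ; sym = ≅-sym ; trans = ≅-trans }
  }

infixr 6 _⊕_

_⊕_ : Tree → Tree → Tree
A ⊕ B = node (subtrees A ++ subtrees B)

-- A₁ + ⋯ + Aₖ; the tree 𝟏 is neutral for ⊕, so it is the empty sum.
⨁ : List Tree → Tree
⨁ = foldr _⊕_ 𝟏

AddPrime : Tree → Set
AddPrime T = 1 < #vertices T ×
  (∀ A B → T ≅ A ⊕ B → (A ≅ 𝟏 × B ≅ T) ⊎ (A ≅ T × B ≅ 𝟏))

AddComposite : Tree → Set
AddComposite T = 1 < #vertices T × ¬ AddPrime T

_IsSumOfPrimes_ : Tree → List Tree → Set
T IsSumOfPrimes As = All AddPrime As × T ≅ ⨁ As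

{-# OPTIONS --safe #-}

-- The add-prime trees are exactly the trees whose root has a single child, so a
-- sum of add-primes lists the subtrees of its root.  What has to be shown is
-- that isomorphic trees have the same root subtrees up to order: an isomorphism
-- permutes the children of the root, and it carries the descendants of a child
-- to the descendants of its image because each descendant is reached from the
-- child along parent edges.
module Submission where

open import Defs
open import Data.List.Base using (List; length)
open import Data.List.Relation.Binary.Permutation.Setoid TreeSetoid using (_↭_)
open import Data.Product.Base using (∃-syntax; _×_)
open import Relation.Binary.PropositionalEquality using (_≡_)

import Algebra.Properties.CommutativeMonoid.Sum as Sum
open import Data.Fin.Base using (Fin; zero; suc)
open import Data.Fin.Permutation using (Permutation; permutation; _⟨$⟩ʳ_)
open import Data.List.Base using ([]; _∷_; [_]; map; lookup)
open import Data.List.Membership.Propositional using (_∈_)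
open import Data.List.Membership.Propositional.Properties using (∈-lookup)
open import Data.List.Properties using (length-map)
open import Data.List.Relation.Binary.Permutation.Setoid TreeSetoid
  using (↭-refl; prep; module PermutationReasoning)
open import Data.List.Relation.Binary.Permutation.Setoid.Properties TreeSetoid
  using (++-commutativeMonoid; xs↭ys⇒|xs|≡|ys|; map⁺)
open import Data.List.Relation.Unary.All as All using (All; []; _∷_)
import Data.List.Relation.Unary.All.Properties as All
open import Data.List.Relation.Unary.Any using (here; there; index)
open import Data.Nat.Base using (s≤s; z≤n)
open import Data.Product.Base using (_,_; proj₁; proj₂)
open import Data.Sum.Base using (_⊎_; inj₁; inj₂)
open import Function.Base using (_∘_)
open import Function.Bundles using (mk⇔; mk↔ₛ′; module Equivalence)
open import Relation.Binary.Bundles using (Setoid)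
open import Relation.Binary.PropositionalEquality
  using (refl; sym; trans; cong; subst; subst₂; module ≡-Reasoning)
open import Relation.Nullary.Negation using (contradiction)

-- Descending into the subtree at `p` turns the motive into `P ∘ below p`; its base case comes from
-- the old one along the edge `top p`.
parent-induction : ∀ {T} (P : Vertex T → Set) → P (rootOf T) →
                   (∀ {v w} → v parentOf w → P v → P w) → ∀ v → P v
parent-induction P base step root        = base
parent-induction P base step (below p v) =
  parent-induction (P ∘ below p) (step (top p) base) (step ∘ below p) v

mk≅ : ∀ {A B} (f : Vertex A → Vertex B) (g : Vertex B → Vertex A) →
      (∀ w → f (g w) ≡ w) → (∀ v → g (f v) ≡ v) → f (rootOf A) ≡ rootOf B →
      (∀ {v w} → v parentOf w → f v parentOf f w) →
      (∀ {v w} → v parentOf w → g v parentOf g w) → A ≅ B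
mk≅ f g f∘g g∘f f-root f-parent g-parent = record
  { vertices         = mk↔ₛ′ f g f∘g g∘f
  ; root-preserved   = f-root
  ; parent-preserved = λ v w → mk⇔ f-parent
      (λ e → subst₂ _parentOf_ (g∘f v) (g∘f w) (g-parent e))
  }

module _ {A B : Tree} (f : A ≅ B) where
  open _≅_ f

  to-parent : ∀ {v w} → v parentOf w → to v parentOf to w
  to-parent {v} {w} = Equivalence.to (parent-preserved v w)

-- Numbering children by `Fin` lets an isomorphism act on them as a `Permutation`, with equal
-- subtrees at different positions kept apart.
child : ∀ {ts} → Fin (length ts) → Vertex (node ts)
child {ts} i = below (∈-lookup i) (rootOf (lookup ts i))

index-∈-lookup : ∀ (ts : List Tree) (i : Fin (length ts)) → index (∈-lookup {xs = ts} i) ≡ i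
index-∈-lookup (t ∷ ts) zero    = refl
index-∈-lookup (t ∷ ts) (suc i) = cong suc (index-∈-lookup ts i)

-- As `t` and `u` may differ, `p` and `q` have different types and are compared through `index`.
below-≡⇒index-≡ : ∀ {ts t u} {p : t ∈ ts} {q : u ∈ ts} {v w} →
                  Vertex.below p v ≡ below q w → index p ≡ index q
below-≡⇒index-≡ refl = refl

child-injective : ∀ {ts} {i j : Fin (length ts)} → child {ts} i ≡ child j → i ≡ j
child-injective {ts} {i} {j} eq =
  trans (sym (index-∈-lookup ts i)) (trans (below-≡⇒index-≡ eq) (index-∈-lookup ts j))

below-rootOf-is-child : ∀ {ts t} (p : t ∈ ts) → ∃[ i ] below p (rootOf t) ≡ child i
below-rootOf-is-child (here refl) = zero , refl
below-rootOf-is-child (there p) with below-rootOf-is-child p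
-- `cong` needs a map on all vertices, hence the clause of `weaken` for `root`.
... | i , eq = suc i , cong weaken eq
  where
  weaken : ∀ {t ts} → Vertex (node ts) → Vertex (node (t ∷ ts))
  weaken root        = root
  weaken (below q v) = below (there q) v

root-parent⇒child : ∀ {ts} {w : Vertex (node ts)} → root parentOf w → ∃[ i ] w ≡ child i
root-parent⇒child (top p) = below-rootOf-is-child p

below-parent⇒below : ∀ {ts t} {p : t ∈ ts} {v w} → below p v parentOf w →
                     ∃[ v′ ] w ≡ below p v′
below-parent⇒below (below p {w = w} e) = w , refl

below-parent⁻ : ∀ {ts t} {p : t ∈ ts} {v w} → below p v parentOf below p w → v parentOf w
below-parent⁻ (below p e) = e

below-injective : ∀ {ts t} {p : t ∈ ts} {v w} → Vertex.below p v ≡ below p w → v ≡ w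
below-injective refl = refl

module _ {ts us : List Tree} (f : node ts ≅ node us) where
  open _≅_ f

  -- Children are the vertices whose parent is the root, and `f` preserves both the root and parent
  -- edges.
  child-image : ∀ i → ∃[ j ] to (child i) ≡ child j
  child-image i = root-parent⇒child
    (subst (_parentOf to (child i)) root-preserved (to-parent f (top (∈-lookup i))))

  σ : Fin (length ts) → Fin (length us)
  σ i = proj₁ (child-image i)

  to-child : ∀ i → to (child i) ≡ child (σ i)
  to-child i = proj₂ (child-image i)

  to-below : ∀ {t u} {p : t ∈ ts} {q : u ∈ us} → to (below p (rootOf t)) ≡ below q (rootOf u) →
             ∀ v → ∃[ w ] to (below p v) ≡ below q w
  -- The image of an edge that starts below `q` also ends below `q`, so the claim passes from parent
  -- to child.
  to-below {p = p} {q} eq = parent-induction _ (_ , eq) λ { {v} {w} e (v′ , eqᵥ) →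
    below-parent⇒below (subst (_parentOf to (below p w)) eqᵥ (to-parent f (below p e))) }

-- Stated for one composite only, so that swapping `f` and `≅-sym f` gives both inverse laws.
σ-inverse : ∀ {ts us} (f : node ts ≅ node us) (g : node us ≅ node ts) →
            (∀ v → _≅_.to g (_≅_.to f v) ≡ v) → ∀ i → σ g (σ f i) ≡ i
σ-inverse f g g∘f i = child-injective (begin
  child (σ g (σ f i))   ≡⟨ to-child g (σ f i) ⟨
  g.to (child (σ f i))  ≡⟨ cong g.to (to-child f i) ⟨
  g.to (f.to (child i)) ≡⟨ g∘f (child i) ⟩
  child i               ∎)
  where
  open ≡-Reasoning
  module f = _≅_ f
  module g = _≅_ g

-- The isomorphism is `f` restricted to the vertices below `p`; each law is checked in the whole
-- tree and pulled back by cancelling `below`.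
subtree-≅ : ∀ {ts us} (f : node ts ≅ node us) {t u} {p : t ∈ ts} {q : u ∈ us} →
            _≅_.to f (below p (rootOf t)) ≡ below q (rootOf u) → t ≅ u
subtree-≅ f {p = p} {q} eq = mk≅
  (proj₁ ∘ down)
  (proj₁ ∘ up)
  (λ w → below-injective (begin
    below q (proj₁ (down (proj₁ (up w)))) ≡⟨ proj₂ (down _) ⟨
    to (below p (proj₁ (up w)))           ≡⟨ cong to (proj₂ (up w)) ⟨
    to (from (below q w))                 ≡⟨ strictlyInverseˡ _ ⟩
    below q w                             ∎))
  (λ v → below-injective (begin
    below p (proj₁ (up (proj₁ (down v)))) ≡⟨ proj₂ (up _) ⟨
    from (below q (proj₁ (down v)))       ≡⟨ cong from (proj₂ (down v)) ⟨
    from (to (below p v))                 ≡⟨ strictlyInverseʳ _ ⟩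
    below p v                             ∎))
  (below-injective (trans (sym (proj₂ (down _))) eq))
  (λ {v} {w} e → below-parent⁻
    (subst₂ _parentOf_ (proj₂ (down v)) (proj₂ (down w)) (to-parent f (below p e))))
  (λ {v} {w} e → below-parent⁻
    (subst₂ _parentOf_ (proj₂ (up v)) (proj₂ (up w)) (to-parent (≅-sym f) (below q e))))
  where
  open ≡-Reasoning
  open _≅_ f
  down = to-below f eq
  up   = to-below (≅-sym f) (trans (cong from (sym eq)) (strictlyInverseʳ _))

-- Lists form a commutative monoid under concatenation up to ↭, in which a list
-- is the sum of its singletons; rearranging a list is then permuting a sum.
open Sum ++-commutativeMonoid using (sum; sum-permute; sum-cong-≋)

sum-singletons : ∀ ts → sum ([_] ∘ lookup ts) ≡ ts
sum-singletons []       = refl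
sum-singletons (t ∷ ts) = cong (t ∷_) (sum-singletons ts)

lookup-permutation⇒↭ : ∀ {ts us} (π : Permutation (length ts) (length us)) →
                       (∀ i → lookup ts i ≅ lookup us (π ⟨$⟩ʳ i)) → ts ↭ us
lookup-permutation⇒↭ {ts} {us} π ts≅us = begin
  ts                                   ≡⟨ sum-singletons ts ⟨
  sum ([_] ∘ lookup ts)                ↭⟨ sum-cong-≋ (λ i → prep (ts≅us i) (↭-refl)) ⟩
  sum (λ i → [ lookup us (π ⟨$⟩ʳ i) ]) ↭⟨ sum-permute ([_] ∘ lookup us) π ⟨
  sum ([_] ∘ lookup us)                ≡⟨ sum-singletons us ⟩
  us                                   ∎
  where open PermutationReasoning

≅⇒subtrees-↭ : ∀ {A B} → A ≅ B → subtrees A ↭ subtrees B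
≅⇒subtrees-↭ {node ts} {node us} f = lookup-permutation⇒↭
  (permutation (σ f) (σ (≅-sym f))
    (σ-inverse (≅-sym f) f strictlyInverseˡ) (σ-inverse f (≅-sym f) strictlyInverseʳ))
  (λ i → subtree-≅ f (to-child f i))
  where open _≅_ f

≅⇒#subtrees-≡ : ∀ {A B} → A ≅ B → #subtrees A ≡ #subtrees B
≅⇒#subtrees-≡ = xs↭ys⇒|xs|≡|ys| ∘ ≅⇒subtrees-↭

planted : Tree → Tree
planted t = node [ t ]

planted-prime : ∀ t → AddPrime (planted t)
-- Matching `t` as a `node` exposes the second vertex to the count.
planted-prime t@(node _) = s≤s (s≤s z≤n) , split
  where
  split : ∀ A B → planted t ≅ A ⊕ B → (A ≅ 𝟏 × B ≅ planted t) ⊎ (A ≅ planted t × B ≅ 𝟏)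
  -- A summand without root subtrees is `𝟏` itself, and the sum then reduces to the other summand.
  split (node [])           (node us)       f = inj₁ (≅-refl , ≅-sym f)
  split (node (a ∷ []))     (node [])       f = inj₂ (≅-sym f , ≅-refl)
  split (node (a ∷ []))     (node (b ∷ us)) f = contradiction (≅⇒#subtrees-≡ f) λ ()
  split (node (a ∷ b ∷ as)) (node us)      f = contradiction (≅⇒#subtrees-≡ f) λ ()

prime⇒planted : ∀ {T} → AddPrime T → ∃[ t ] T ≡ planted t
prime⇒planted {node []}           (s≤s () , _)
prime⇒planted {node (t ∷ [])}     _           = t , refl
-- Splitting off the first of several root subtrees leaves two summands, neither of which is `𝟏`.
prime⇒planted {node (t ∷ u ∷ ts)} (_ , split) = contradiction (split (planted t) (node (u ∷ ts)) ≅-refl) λ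
  { (inj₁ (t≅𝟏 , _)) → contradiction (≅⇒#subtrees-≡ t≅𝟏) λ ()
  ; (inj₂ (_ , u≅𝟏)) → contradiction (≅⇒#subtrees-≡ u≅𝟏) λ () }

-- Lets a rearrangement of root subtrees, which holds only up to `≅`, be carried over to the
-- add-primes planted from them.
planted-cong : ∀ {t u} → t ≅ u → planted t ≅ planted u
planted-cong f = mk≅ (graft to) (graft from)
  (graft-inverse strictlyInverseˡ) (graft-inverse strictlyInverseʳ) refl
  (graft-parent root-preserved (to-parent f))
  (graft-parent (_≅_.root-preserved (≅-sym f)) (to-parent (≅-sym f)))
  where
  open _≅_ f

  graft : ∀ {t u} → (Vertex t → Vertex u) → Vertex (planted t) → Vertex (planted u)
  graft g root                  = root
  graft g (below (here refl) v) = below (here refl) (g v)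

  graft-inverse : ∀ {t u} {g : Vertex t → Vertex u} {h : Vertex u → Vertex t} →
                  (∀ w → g (h w) ≡ w) → ∀ w → graft g (graft h w) ≡ w
  graft-inverse inv root                  = refl
  graft-inverse inv (below (here refl) v) = cong (below (here refl)) (inv v)

  graft-parent : ∀ {t u} {g : Vertex t → Vertex u} → g (rootOf t) ≡ rootOf u →
                 (∀ {v w} → v parentOf w → g v parentOf g w) →
                 ∀ {v w} → v parentOf w → graft g v parentOf graft g w
  graft-parent g-root g-parent (top (here refl)) =
    subst (λ w → root parentOf below (here refl) w) (sym g-root) (top (here refl))
  graft-parent g-root g-parent (below (here refl) e) = below (here refl) (g-parent e)

⨁-planted : ∀ ts → ⨁ (map planted ts) ≡ node ts
⨁-planted []       = refl
⨁-planted (t ∷ ts) = cong (planted t ⊕_) (⨁-planted ts)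

-- Each add-prime contributes exactly one root subtree to the sum, so the terms can be read back
-- from it in order.
primes-planted : ∀ {Bs} → All AddPrime Bs → Bs ≡ map planted (subtrees (⨁ Bs))
primes-planted []       = refl
primes-planted (p ∷ ps) with t , refl ← prime⇒planted p = cong (planted t ∷_) (primes-planted ps)

mainTheorem4 : (T : Tree) → AddComposite T → ∃[ As ] (length As ≡ #subtrees T × T IsSumOfPrimes As × (∀ (Bs : List Tree) → T IsSumOfPrimes Bs → Bs ↭ As))
mainTheorem4 T@(node ts) _ =
  -- The factors are the root subtrees of `T`, each planted under a new root.
  map planted ts , length-map planted ts ,
  (All.map⁺ (All.universal planted-prime ts) , Setoid.reflexive TreeSetoid (sym (⨁-planted ts))) ,
  unique
  where
  open PermutationReasoning
  unique : ∀ Bs → T IsSumOfPrimes Bs → Bs ↭ map planted ts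
  unique Bs (Bs-prime , T≅⨁Bs) = begin
    Bs                            ≡⟨ primes-planted Bs-prime ⟩
    map planted (subtrees (⨁ Bs)) ↭⟨ map⁺ TreeSetoid planted-cong (≅⇒subtrees-↭ (≅-sym T≅⨁Bs)) ⟩
    map planted ts                ∎
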